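{- Let $\sigma,\pi\in S_n$. Then $[\sigma]\prec[\pi]$ if and only if there exists $\rho\in S_n$ such that (1) $\rho\ast E(\sigma)\subset E(\pi)$ (proper inclusion); and (2) $\rho$ is either order-preserving on $E(\sigma)$ (on every element of $E(\sigma)$) or order-reversing on $E(\sigma)$ (on every element of $E(\sigma)$).
   Context: Inversion set: $E(\pi)=\{(i,j):1\le i<j\le n,\ \pi^{ -1}(i)>\pi^{ -1}(j)\}$. Action: for $\sigma,\rho\in S_n$ and $(i,j)\in E(\sigma)$, $\rho\ast(i,j)=(\rho(i),\rho(j))$ if $\rho(i)<\rho(j)$ ($\rho$ is order-preserving on $(i,j)$) and $\rho\ast(i,j)=(\rho(j),\rho(i))$ if $\rho(i)>\rho(j)$ ($\rho$ is order-reversing on $(i,j)$); $\rho\ast E(\sigma)=\{\rho\ast(i,j):(i,j)\in E(\sigma)\}$. Geometric graphs: a geometric graph is a simple graph together with a straight-line drawing in the plane with vertices in general position (no three vertices collinear, no three edges crossing at a single point). Two edges cross if they meet at a point interior to both. A geo-isomorphism is a vertex bijection preserving adjacency, non-adjacency, crossings and non-crossings of edges. For geometric realizations $\overline{G},\widehat{G}$ of a simple graph $G$, $\overline{G}\preceq\widehat{G}$ iff there is a graph isomorphism $f:G\to G$ such that whenever $xy$ crosses $uv$ in $\overline G$, $f(x)f(y)$ crosses $f(u)f(v)$ in $\widehat G$; this is a partial order on geo-isomorphism classes of realizations of $G$. The vertex set of $K_{2,n}$ is $\{a,b\}\cup\{1,\dots,n\}$, with $a$ and $b$ each adjacent to all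 of $1,\dots,n$. Realization $\overline{K}_{2,n}(\pi)$ for $\pi\in S_n$: from each of two points $a,b\in\mathbb{R}^2$ draw $n$ rays, all on the same side of the line $ab$, such that each ray from $a$ meets each ray from $b$ (and generic, so that general position holds). Label the rays from $b$ as $1,\dots,n$ in increasing order of the angle they make with the segment $ba$; label the rays from $a$ as $\pi(1),\dots,\pi(n)$ in increasing order of the angle they make with the segment $ab$. Place vertex $i$ at the intersection of the two rays labeled $i$, and draw the segments $ai$, $bi$ for all $i$. Geo-equivalence and order: $\sigma\sim\pi$ iff $\overline{K}_{2,n}(\sigma)$ and $\overline{K}_{2,n}(\pi)$ are geo-isomorphic; $[\pi]$ is the equivalence class of $\pi$ in $S_n$; $[\sigma]\preceq[\pi]$ iff $\overline{K}_{2,n}(\sigma)\preceq\overline{K}_{2,n}(\pi)$; $[\sigma]\prec[\pi]$ means $[\sigma]\preceq[\pi]$ and $[\sigma]\ne[\pi]$. -}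

module Defs where

open import Level using (Level; _⊔_; 0ℓ) renaming (suc to lsuc)
open import Algebra.Apartness.Bundles using (HeytingField)
open import Data.Bool.Base using (if_then_else_)
open import Data.Fin.Base using (Fin; _<_; _>_)
open import Data.Fin.Permutation using (Permutation′; _⟨$⟩ʳ_; _⟨$⟩ˡ_)
open import Data.Fin.Properties using (_<?_)
open import Data.Nat.Base as ℕ using (ℕ)
open import Data.Product.Base using (_×_; _,_; ∃-syntax)
open import Data.Sum.Base using (_⊎_)
open import Function.Bundles using (_↔_; _⇔_; Inverse)
open import Relation.Binary.Core using (Rel)
open import Relation.Binary.PropositionalEquality.Core using (_≡_; _≢_)
open import Relation.Binary.Structures using (IsStrictPartialOrder)
open import Relation.Nullary.Decidable.Core using (does)
open import Relation.Nullary.Negation.Core using (¬_)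
open import Relation.Unary using (Pred; _∈_)

------------------------------------------------------------------------
-- Permutations.  The letters 1, …, n are the elements of Fin n.

E : ∀ {n} → Permutation′ n → Pred (Fin n × Fin n) 0ℓ
E π (i , j) = i < j × (π ⟨$⟩ˡ i) > (π ⟨$⟩ˡ j)

act : ∀ {n} → Permutation′ n → Fin n × Fin n → Fin n × Fin n
act ρ (i , j) =
  if does ((ρ ⟨$⟩ʳ i) <? (ρ ⟨$⟩ʳ j))
  then (ρ ⟨$⟩ʳ i , ρ ⟨$⟩ʳ j)
  else (ρ ⟨$⟩ʳ j , ρ ⟨$⟩ʳ i)

infixr 6 _∗_

_∗_ : ∀ {n} → Permutation′ n → Pred (Fin n × Fin n) 0ℓ → Pred (Fin n × Fin n) 0ℓ
(ρ ∗ P) q = ∃[ p ] (p ∈ P × q ≡ act ρ p)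

OrderPreservingOn : ∀ {n} → Permutation′ n → Pred (Fin n × Fin n) 0ℓ → Set
OrderPreservingOn ρ P = ∀ i j → (i , j) ∈ P → (ρ ⟨$⟩ʳ i) < (ρ ⟨$⟩ʳ j)

OrderReversingOn : ∀ {n} → Permutation′ n → Pred (Fin n × Fin n) 0ℓ → Set
OrderReversingOn ρ P = ∀ i j → (i , j) ∈ P → (ρ ⟨$⟩ʳ i) > (ρ ⟨$⟩ʳ j)

------------------------------------------------------------------------
-- Graphs

record SimpleGraph : Set₁ where
  field
    Vertex : Set
    Adj    : Vertex → Vertex → Set
    sym    : ∀ {x y} → Adj x y → Adj y x
    irrefl : ∀ {x} → ¬ Adj x x

data K₂-Vertex (n : ℕ) : Set where
  a b : K₂-Vertex n
  pt  : Fin n → K₂-Vertex n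

data K₂-Adj {n : ℕ} : K₂-Vertex n → K₂-Vertex n → Set where
  a–pt : ∀ i → K₂-Adj a (pt i)
  b–pt : ∀ i → K₂-Adj b (pt i)
  pt–a : ∀ i → K₂-Adj (pt i) a
  pt–b : ∀ i → K₂-Adj (pt i) b

K₂ : ℕ → SimpleGraph
K₂ n = record
  { Vertex = K₂-Vertex n
  ; Adj    = K₂-Adj
  ; sym    = λ { (a–pt i) → pt–a i ; (b–pt i) → pt–b i
               ; (pt–a i) → a–pt i ; (pt–b i) → b–pt i }
  ; irrefl = λ ()
  }

------------------------------------------------------------------------
-- The real numbers, axiomatised as a Cauchy-complete Archimedean ordered
-- field.  Classically such a field is unique up to isomorphism.  The order
-- is not assumed decidable, so the constructive reals are a model as well.

record OrderedField (c ℓ₁ ℓ₂ ℓ₃ : Level) : Set (lsuc (c ⊔ ℓ₁ ⊔ ℓ₂ ⊔ ℓ₃)) where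
  field
    heytingField : HeytingField c ℓ₁ ℓ₂
  open HeytingField heytingField

  infix 4 _<ᴿ_
  field
    _<ᴿ_                 : Rel Carrier ℓ₃
    isStrictPartialOrder : IsStrictPartialOrder _≈_ _<ᴿ_
    #⇒<ᴿ⊎>ᴿ              : ∀ {x y} → x # y → x <ᴿ y ⊎ y <ᴿ x
    <ᴿ⇒#                 : ∀ {x y} → x <ᴿ y → x # y
    +-monoˡ-<ᴿ           : ∀ {x y} z → x <ᴿ y → x + z <ᴿ y + z
    *-positive           : ∀ {x y} → 0# <ᴿ x → 0# <ᴿ y → 0# <ᴿ x * y

module _ {c ℓ₁ ℓ₂ ℓ₃ : Level} (K : OrderedField c ℓ₁ ℓ₂ ℓ₃) where
  open OrderedField K
  open HeytingField heytingField

  fromℕ : ℕ → Carrier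
  fromℕ ℕ.zero    = 0#
  fromℕ (ℕ.suc n) = 1# + fromℕ n

  Archimedean : Set (c ⊔ ℓ₃)
  Archimedean = ∀ x → ∃[ n ] x <ᴿ fromℕ n

  -- Since k and l may be exchanged, this bounds |xₖ − xₗ| by ε.
  Cauchy : (ℕ → Carrier) → Set (c ⊔ ℓ₃)
  Cauchy x = ∀ ε → 0# <ᴿ ε →
    ∃[ N ] (∀ k l → N ℕ.≤ k → N ℕ.≤ l → x k <ᴿ x l + ε)

  _ConvergesTo_ : (ℕ → Carrier) → Carrier → Set (c ⊔ ℓ₃)
  x ConvergesTo L = ∀ ε → 0# <ᴿ ε →
    ∃[ N ] (∀ k → N ℕ.≤ k → (x k <ᴿ L + ε) × (L <ᴿ x k + ε))

  Complete : Set (c ⊔ ℓ₃)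
  Complete = ∀ x → Cauchy x → ∃[ L ] x ConvergesTo L

record RealNumbers (c ℓ₁ ℓ₂ ℓ₃ : Level) : Set (lsuc (c ⊔ ℓ₁ ⊔ ℓ₂ ⊔ ℓ₃)) where
  field
    orderedField : OrderedField c ℓ₁ ℓ₂ ℓ₃
    archimedean  : Archimedean orderedField
    complete     : Complete orderedField
  open OrderedField orderedField public
  open HeytingField heytingField public

------------------------------------------------------------------------
-- Plane geometry

module Plane {c ℓ₁ ℓ₂ ℓ₃ : Level} (ℝ : RealNumbers c ℓ₁ ℓ₂ ℓ₃) where
  open RealNumbers ℝ

  Point : Set c
  Point = Carrier × Carrier

  infix  4 _≈ₚ_
  infixl 6 _+ₚ_ _-ₚ_
  infixl 7 _·ₚ_

  _≈ₚ_ : Point → Point → Set ℓ₁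
  (x , y) ≈ₚ (x′ , y′) = x ≈ x′ × y ≈ y′

  _+ₚ_ _-ₚ_ : Point → Point → Point
  (x , y) +ₚ (x′ , y′) = (x + x′ , y + y′)
  (x , y) -ₚ (x′ , y′) = (x - x′ , y - y′)

  _·ₚ_ : Carrier → Point → Point
  t ·ₚ (x , y) = (t * x , t * y)

  -- positive iff the second direction points to the left of the first
  det : Point → Point → Carrier
  det (x , y) (x′ , y′) = x * y′ - y * x′

  Collinear : Point → Point → Point → Set ℓ₁
  Collinear p q r = det (q -ₚ p) (r -ₚ p) ≈ 0#

  -- p lies in the interior of the segment qr
  InSegment : Point → Point → Point → Set (c ⊔ ℓ₁ ⊔ ℓ₃)
  InSegment p q r =
    ∃[ t ] (0# <ᴿ t × t <ᴿ 1# × p ≈ₚ q +ₚ t ·ₚ (r -ₚ q))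

  -- p lies on the ray from q in direction d, and is not q itself
  OnRay : Point → Point → Point → Set (c ⊔ ℓ₁ ⊔ ℓ₃)
  OnRay p q d = ∃[ t ] (0# <ᴿ t × p ≈ₚ q +ₚ t ·ₚ d)

  -- For rays in directions d and d′ on the same side of the line spanned by
  -- e: the angle between e and d is smaller than the one between e and d′,
  -- that is, d lies in the interior of the angle formed by e and d′.
  SmallerAngle : Point → Point → Point → Set (c ⊔ ℓ₁ ⊔ ℓ₃)
  SmallerAngle e d d′ =
    ∃[ s ] ∃[ t ] (0# <ᴿ s × 0# <ᴿ t × d ≈ₚ s ·ₚ e +ₚ t ·ₚ d′)

------------------------------------------------------------------------
-- Geometric graphs

module _ {c ℓ₁ ℓ₂ ℓ₃ : Level} (ℝ : RealNumbers c ℓ₁ ℓ₂ ℓ₃) (G : SimpleGraph) where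
  open Plane ℝ
  open SimpleGraph G

  SameEdge : Vertex → Vertex → Vertex → Vertex → Set
  SameEdge x y u v = (x ≡ u × y ≡ v) ⊎ (x ≡ v × y ≡ u)

  CrossAt : (Vertex → Point) → Point → (x y u v : Vertex) → Set (c ⊔ ℓ₁ ⊔ ℓ₃)
  CrossAt pos p x y u v =
    Adj x y × Adj u v × ¬ SameEdge x y u v ×
    InSegment p (pos x) (pos y) × InSegment p (pos u) (pos v)

  -- a realization of G as a geometric graph
  record Realization : Set (c ⊔ ℓ₁ ⊔ ℓ₃) where
    field
      pos               : Vertex → Point
      pos-distinct      : ∀ {x y} → x ≢ y → ¬ pos x ≈ₚ pos y
      noThreeCollinear  : ∀ {x y z} → x ≢ y → y ≢ z → x ≢ z →
                          ¬ Collinear (pos x) (pos y) (pos z)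
      noThreeConcurrent : ∀ {p x y u v w z} → CrossAt pos p x y u v →
                          CrossAt pos p u v w z → ¬ CrossAt pos p x y w z

module _ {c ℓ₁ ℓ₂ ℓ₃ : Level} {ℝ : RealNumbers c ℓ₁ ℓ₂ ℓ₃} {G : SimpleGraph} where
  open SimpleGraph G
  open Realization

  Cross : Realization ℝ G → (x y u v : Vertex) → Set (c ⊔ ℓ₁ ⊔ ℓ₃)
  Cross R x y u v = ∃[ p ] CrossAt ℝ G (pos R) p x y u v

  IsAutomorphism : Vertex ↔ Vertex → Set
  IsAutomorphism f = ∀ x y → Adj x y ⇔ Adj (to x) (to y)
    where open Inverse f using (to)

  infix 4 _≅_ _≼_ _≺_

  -- geo-isomorphism
  _≅_ : Realization ℝ G → Realization ℝ G → Set (c ⊔ ℓ₁ ⊔ ℓ₃)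
  R ≅ S = ∃[ f ] (IsAutomorphism f ×
    (let open Inverse f using (to) in
     ∀ x y u v → Cross R x y u v ⇔ Cross S (to x) (to y) (to u) (to v)))

  _≼_ : Realization ℝ G → Realization ℝ G → Set (c ⊔ ℓ₁ ⊔ ℓ₃)
  R ≼ S = ∃[ f ] (IsAutomorphism f ×
    (let open Inverse f using (to) in
     ∀ x y u v → Cross R x y u v → Cross S (to x) (to y) (to u) (to v)))

  -- the strict order on geo-isomorphism classes
  _≺_ : Realization ℝ G → Realization ℝ G → Set (c ⊔ ℓ₁ ⊔ ℓ₃)
  R ≺ S = R ≼ S × ¬ (R ≅ S)

------------------------------------------------------------------------
-- The realizations of K₂,ₙ determined by a permutation

record RayRealization {c ℓ₁ ℓ₂ ℓ₃ : Level} (ℝ : RealNumbers c ℓ₁ ℓ₂ ℓ₃)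
                      {n : ℕ} (π : Permutation′ n) : Set (c ⊔ ℓ₁ ⊔ ℓ₃) where
  open RealNumbers ℝ using (0#; _<ᴿ_)
  open Plane ℝ
  field
    realization : Realization ℝ (K₂ n)
  open Realization realization public

  ab : Point
  ab = pos b -ₚ pos a

  ba : Point
  ba = pos a -ₚ pos b

  field
    -- directions of the rays from a and from b, listed by increasing angle
    α β          : Fin n → Point
    sameSide     : ((∀ k → 0# <ᴿ det ab (α k)) × (∀ k → 0# <ᴿ det ab (β k)))
                 ⊎ ((∀ k → det ab (α k) <ᴿ 0#) × (∀ k → det ab (β k) <ᴿ 0#))
    α-increasing : ∀ {k l} → k < l → SmallerAngle ab (α k) (α l)
    β-increasing : ∀ {k l} → k < l → SmallerAngle ba (β k) (β l)
    -- The intersection point is never a or b, by sameSide, so it is harmless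
    -- that OnRay excludes the apex.
    meet         : ∀ k l → ∃[ p ] (OnRay p (pos a) (α k) × OnRay p (pos b) (β l))
    -- The k-th ray from a is labelled π(k), so label i is on ray π⁻¹(i).
    pt-on-α      : ∀ i → OnRay (pos (pt i)) (pos a) (α (π ⟨$⟩ˡ i))
    pt-on-β      : ∀ i → OnRay (pos (pt i)) (pos b) (β i)

{-# OPTIONS --safe #-}

-- For i < j, the edges bi and aj of K̄(π) cross iff (i , j) ∈ E(π), and there
-- are no other crossings: since the angles at a and b order the points by π⁻¹
-- and by label, this is a matter of signs of areas of triangles.  Unless n = 2,
-- an automorphism of K₂,ₙ is a permutation ρ of the points, possibly followed
-- by the exchange of a and b.  Such an automorphism maps crossings to crossings
-- iff ρ maps inversions to inversions, and does so preserving their order if a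
-- and b are fixed, reversing it if they are exchanged.
-- For strictness, let f : K̄(σ) → K̄(π) preserve crossings and let g be a
-- geo-isomorphism.  Then f ∘ g⁻¹ is a permutation of the finite set of
-- quadruples of vertices that preserves the crossings of K̄(π), so it reflects
-- them too, and hence so does f.

module Submission where

open import Defs
open import Level using (Level; 0ℓ)
open import Algebra.Apartness.Bundles using (module HeytingCommutativeRing)
open import Algebra.Bundles using (CommutativeRing)
import Algebra.Properties.AbelianGroup
import Algebra.Properties.Ring
import Algebra.Properties.Semiring.Mult.TCOptimised
import Algebra.Solver.Ring
open import Algebra.Solver.Ring.AlmostCommutativeRing
  using (fromCommutativeRing; _-Raw-AlmostCommutative⟶_)
open import Data.Bool.Base using (Bool; true; false)
open import Data.Fin.Base using (Fin; zero; suc; toℕ; combine; _<_)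
open import Data.Fin.Permutation as Perm
  using (Permutation′; permutation; _⟨$⟩ʳ_; _⟨$⟩ˡ_; inverseʳ; flip)
open import Data.Fin.Properties
  using (pigeonhole; injective⇒≤; combine-injective; <-asym; <-cmp; _<?_)
open import Data.Integer.Base as ℤ using (ℤ; +_; -[1+_])
import Data.Integer.Properties as ℤ
open import Data.Maybe.Base using (Maybe; just; nothing)
open import Data.Nat.Base as ℕ using (ℕ; zero; suc; z≤n; s≤s)
open import Data.Nat.GeneralisedArithmetic using (fold; fold-+)
import Data.Nat.Properties as ℕ
open import Data.Product.Base as Product using (_×_; _,_; ∃-syntax; proj₁; proj₂)
import Data.Sign.Base as Sign
open import Data.Sum.Base using (_⊎_; inj₁; inj₂)
open import Function.Base using (id; _∘_)
open import Function.Bundles using (_↔_; _⇔_; Inverse; Injection; Equivalence; mk⇔; mk↔ₛ′)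
open import Function.Definitions using (Injective)
open import Function.Properties.Inverse using (↔⇒↣; ↔-sym)
open import Relation.Binary.Definitions using (tri<; tri≈; tri>)
import Relation.Binary.PropositionalEquality.Core as ≡
open import Relation.Binary.Structures using (module IsStrictPartialOrder)
import Relation.Binary.Reasoning.Setoid
open import Relation.Nullary.Decidable using (yes; no; dec-true; dec-false)
open import Relation.Nullary.Negation.Core using (¬_; contradiction)
open import Relation.Unary using (Pred; _∈_; _⊆_; _⊂_)
open ≡ using (_≡_; _≢_)

-- Integer coefficients for the ring solver

module ℤ-Solver {c ℓ} (R : CommutativeRing c ℓ) where
  open CommutativeRing R
  open Algebra.Properties.Ring ring
  open Algebra.Properties.AbelianGroup +-abelianGroup using (⁻¹-∙-comm)
  open Algebra.Properties.Semiring.Mult.TCOptimised semiring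
    using (×-homo-+; ×1-homo-*; 1+×) renaming (_×_ to _×′_)
  open Relation.Binary.Reasoning.Setoid setoid

  -- The canonical homomorphism from the integers. Equality in the ring need not be decidable, so
  -- polynomials are normalised over coefficients that can be compared.
  ⟦_⟧ : ℤ → Carrier
  ⟦ + n      ⟧ = n ×′ 1#
  ⟦ -[1+ n ] ⟧ = - (suc n ×′ 1#)

  ⊖-homo : ∀ m n → ⟦ m ℤ.⊖ n ⟧ ≈ m ×′ 1# - n ×′ 1#
  ⊖-homo zero    zero    = sym (-‿inverseʳ 0#)
  ⊖-homo zero    (suc n) = sym (+-identityˡ _)
  ⊖-homo (suc m) zero    = sym (trans (+-congˡ -0#≈0#) (+-identityʳ _))
  ⊖-homo (suc m) (suc n) = begin
    ⟦ suc m ℤ.⊖ suc n ⟧              ≡⟨ ≡.cong ⟦_⟧ (ℤ.[1+m]⊖[1+n]≡m⊖n m n) ⟩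
    ⟦ m ℤ.⊖ n ⟧                      ≈⟨ ⊖-homo m n ⟩
    -- Insert `1# - 1#`, so that both terms of the difference gain one unit.
    m ×′ 1# - n ×′ 1#                ≈⟨ +-congʳ (+-identityʳ _) ⟨
    m ×′ 1# + 0# - n ×′ 1#           ≈⟨ +-congʳ (+-congˡ (-‿inverseʳ 1#)) ⟨
    m ×′ 1# + (1# - 1#) - n ×′ 1#    ≈⟨ +-congʳ (+-assoc _ _ _) ⟨
    m ×′ 1# + 1# - 1# - n ×′ 1#      ≈⟨ +-congʳ (+-congʳ (+-comm _ _)) ⟩
    1# + m ×′ 1# - 1# - n ×′ 1#      ≈⟨ +-assoc _ _ _ ⟩
    1# + m ×′ 1# + (- 1# - n ×′ 1#)  ≈⟨ +-congˡ (⁻¹-∙-comm _ _) ⟩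
    1# + m ×′ 1# - (1# + n ×′ 1#)    ≈⟨ +-cong (1+× m 1#) (-‿cong (1+× n 1#)) ⟨
    suc m ×′ 1# - suc n ×′ 1#        ∎

  +-homo : ∀ i j → ⟦ i ℤ.+ j ⟧ ≈ ⟦ i ⟧ + ⟦ j ⟧
  +-homo (+ m)    (+ n)    = ×-homo-+ 1# m n
  +-homo (+ m)    -[1+ n ] = ⊖-homo m (suc n)
  +-homo -[1+ m ] (+ n)    = trans (⊖-homo n (suc m)) (+-comm _ _)
  +-homo -[1+ m ] -[1+ n ] = begin
    - (suc (suc (m ℕ.+ n)) ×′ 1#)  ≡⟨ ≡.cong (λ k → - (suc k ×′ 1#)) (ℕ.+-suc m n) ⟨
    - ((suc m ℕ.+ suc n) ×′ 1#)    ≈⟨ -‿cong (×-homo-+ 1# (suc m) (suc n)) ⟩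
    - (suc m ×′ 1# + suc n ×′ 1#)  ≈⟨ ⁻¹-∙-comm _ _ ⟨
    - (suc m ×′ 1#) - suc n ×′ 1#  ∎

  +◃-homo : ∀ n → ⟦ Sign.+ ℤ.◃ n ⟧ ≈ n ×′ 1#
  +◃-homo zero    = refl
  +◃-homo (suc n) = refl

  -◃-homo : ∀ n → ⟦ Sign.- ℤ.◃ n ⟧ ≈ - (n ×′ 1#)
  -◃-homo zero    = sym -0#≈0#
  -◃-homo (suc n) = refl

  *-homo : ∀ i j → ⟦ i ℤ.* j ⟧ ≈ ⟦ i ⟧ * ⟦ j ⟧
  *-homo (+ m)    (+ n)    = trans (+◃-homo (m ℕ.* n)) (×1-homo-* m n)
  *-homo (+ m)    -[1+ n ] = begin
    ⟦ Sign.- ℤ.◃ (m ℕ.* suc n) ⟧  ≈⟨ -◃-homo (m ℕ.* suc n) ⟩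
    - ((m ℕ.* suc n) ×′ 1#)       ≈⟨ -‿cong (×1-homo-* m (suc n)) ⟩
    - (m ×′ 1# * suc n ×′ 1#)     ≈⟨ -‿distribʳ-* _ _ ⟩
    m ×′ 1# * - (suc n ×′ 1#)     ∎
  *-homo -[1+ m ] (+ n)    = begin
    ⟦ Sign.- ℤ.◃ (suc m ℕ.* n) ⟧  ≈⟨ -◃-homo (suc m ℕ.* n) ⟩
    - ((suc m ℕ.* n) ×′ 1#)       ≈⟨ -‿cong (×1-homo-* (suc m) n) ⟩
    - (suc m ×′ 1# * n ×′ 1#)     ≈⟨ -‿distribˡ-* _ _ ⟩
    - (suc m ×′ 1#) * n ×′ 1#     ∎
  *-homo -[1+ m ] -[1+ n ] = begin
    ⟦ Sign.+ ℤ.◃ (suc m ℕ.* suc n) ⟧   ≈⟨ +◃-homo (suc m ℕ.* suc n) ⟩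
    (suc m ℕ.* suc n) ×′ 1#            ≈⟨ ×1-homo-* (suc m) (suc n) ⟩
    suc m ×′ 1# * suc n ×′ 1#          ≈⟨ -‿involutive _ ⟨
    - - (suc m ×′ 1# * suc n ×′ 1#)    ≈⟨ -‿cong (-‿distribʳ-* _ _) ⟩
    - (suc m ×′ 1# * - (suc n ×′ 1#))  ≈⟨ -‿distribˡ-* _ _ ⟩
    - (suc m ×′ 1#) * - (suc n ×′ 1#)  ∎

  -‿homo : ∀ i → ⟦ ℤ.- i ⟧ ≈ - ⟦ i ⟧
  -‿homo (+ zero)  = sym -0#≈0#
  -‿homo (+ suc n) = refl
  -‿homo -[1+ n ]  = sym (-‿involutive _)

  morphism : ℤ.+-*-rawRing -Raw-AlmostCommutative⟶ fromCommutativeRing R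
  morphism = record
    { ⟦_⟧ = ⟦_⟧ ; +-homo = +-homo ; *-homo = *-homo ; -‿homo = -‿homo
    ; 0-homo = refl ; 1-homo = refl }

  _coeff≟_ : ∀ i j → Maybe (⟦ i ⟧ ≈ ⟦ j ⟧)
  i coeff≟ j with i ℤ.≟ j
  ... | yes ≡.refl = just refl
  ... | no _       = nothing

  open Algebra.Solver.Ring ℤ.+-*-rawRing (fromCommutativeRing R) morphism _coeff≟_ public
    using (Polynomial; solve; _:=_; _:+_; _:*_; _:-_; :-_; con)

-- Arithmetic of the ordered field

module Order {c ℓ₁ ℓ₂ ℓ₃} (ℝ : RealNumbers c ℓ₁ ℓ₂ ℓ₃) where
  open RealNumbers ℝ
  open IsStrictPartialOrder isStrictPartialOrder public
    using () renaming
      ( irrefl    to <ᴿ-irrefl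
      ; trans     to <ᴿ-trans
      ; <-respʳ-≈ to <ᴿ-respʳ-≈
      ; <-respˡ-≈ to <ᴿ-respˡ-≈
      )

  commutativeRing : CommutativeRing c ℓ₁
  commutativeRing = HeytingCommutativeRing.commutativeRing heytingCommutativeRing
  open CommutativeRing commutativeRing public using (setoid; ring)
  open ℤ-Solver commutativeRing public using (Polynomial; solve; _:=_; _:+_; _:*_; _:-_; :-_; con)

  Positive : Carrier → Set ℓ₃
  Positive x = 0# <ᴿ x

  pos-resp : ∀ {x y} → x ≈ y → Positive x → Positive y
  pos-resp = <ᴿ-respʳ-≈

  ¬pos-0 : ∀ {x} → x ≈ 0# → ¬ Positive x
  ¬pos-0 x≈0 0<x = <ᴿ-irrefl (sym x≈0) 0<x

  +-positive : ∀ {x y} → Positive x → Positive y → Positive (x + y)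
  +-positive {x} {y} 0<x 0<y =
    <ᴿ-trans 0<y (<ᴿ-respˡ-≈ (+-identityˡ y) (+-monoˡ-<ᴿ y 0<x))

  <ᴿ⇒positive : ∀ {x y} → x <ᴿ y → Positive (y - x)
  <ᴿ⇒positive {x} x<y = <ᴿ-respˡ-≈ (-‿inverseʳ x) (+-monoˡ-<ᴿ (- x) x<y)

  positive⇒<ᴿ : ∀ {x y} → Positive (y - x) → x <ᴿ y
  positive⇒<ᴿ {x} {y} 0<y-x = <ᴿ-respˡ-≈ (+-identityˡ x)
    (<ᴿ-respʳ-≈ (solve 2 (λ x y → (y :- x) :+ x := y) refl x y) (+-monoˡ-<ᴿ x 0<y-x))

  <ᴿ0⇒positive : ∀ {x} → x <ᴿ 0# → Positive (- x)
  <ᴿ0⇒positive x<0 = pos-resp (+-identityˡ _) (<ᴿ⇒positive x<0)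

  #0⇒square-positive : ∀ {x} → x # 0# → Positive (x * x)
  #0⇒square-positive {x} x#0 with #⇒<ᴿ⊎>ᴿ x#0
  ... | inj₂ 0<x = *-positive 0<x 0<x
  ... | inj₁ x<0 = pos-resp (solve 1 (λ x → (:- x) :* (:- x) := x :* x) refl x)
                     (*-positive (<ᴿ0⇒positive x<0) (<ᴿ0⇒positive x<0))

  -- The inverse is positive because `w ≈ x * (w * w)`: being invertible, `w` is apart from zero, so
  -- its square is positive. Invertibility is given for the difference `x - 0#`, hence the
  -- rewriting.
  reciprocal : ∀ {x} → Positive x → ∃[ w ] (Positive w × w * x ≈ 1#)
  reciprocal {x} 0<x with #⇒invertible (#-sym (<ᴿ⇒# 0<x))
  ... | w , w[x-0]≈1 , _ = w , 0<w , wx≈1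
    where
    wx≈1 : w * x ≈ 1#
    wx≈1 = trans (solve 2 (λ w x → w :* x := w :* (x :- con (+ 0))) refl w x) w[x-0]≈1

    w#0 : w # 0#
    w#0 = invertible⇒# (x ,
      trans (solve 2 (λ w x → x :* (w :- con (+ 0)) := w :* x) refl w x) wx≈1 ,
      trans (solve 2 (λ w x → (w :- con (+ 0)) :* x := w :* x) refl w x) wx≈1)

    0<w : Positive w
    0<w = pos-resp
      (trans (solve 2 (λ w x → x :* (w :* w) := (w :* x) :* w) refl w x)
        (trans (*-congʳ wx≈1) (*-identityˡ w)))
      (*-positive 0<x (#0⇒square-positive w#0))

  *-zeroʳ : ∀ t {x} → x ≈ 0# → t * x ≈ 0#
  *-zeroʳ t x≈0 = trans (*-congˡ x≈0) (zeroʳ t)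

  +-zeroˡ : ∀ {x y} → x ≈ 0# → x + y ≈ y
  +-zeroˡ {y = y} x≈0 = trans (+-congʳ x≈0) (+-identityˡ y)

  +-zeroʳ : ∀ {x y} → y ≈ 0# → x + y ≈ x
  +-zeroʳ {x} y≈0 = trans (+-congˡ y≈0) (+-identityʳ x)

-- Signed areas and fans of rays

module Orientation {c ℓ₁ ℓ₂ ℓ₃} (ℝ : RealNumbers c ℓ₁ ℓ₂ ℓ₃) where
  open RealNumbers ℝ
  open Order ℝ
  open Plane ℝ

  det-cong : ∀ {p p′ q q′} → p ≈ₚ p′ → q ≈ₚ q′ → det p q ≈ det p′ q′
  det-cong (x , y) (x′ , y′) = +-cong (*-cong x y′) (-‿cong (*-cong y x′))

  ≈ₚ-refl : ∀ {p} → p ≈ₚ p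
  ≈ₚ-refl = refl , refl

  -- The component along `d` drops out. This turns a comparison of angles into the sign of a
  -- determinant.
  det-smallerAngle : ∀ s t e d → det (s ·ₚ e +ₚ t ·ₚ d) d ≈ s * det e d
  det-smallerAngle s t (ex , ey) (dx , dy) =
    solve 6 (λ s t ex ey dx dy →
      (s :* ex :+ t :* dx) :* dy :- (s :* ey :+ t :* dy) :* dx := s :* (ex :* dy :- ey :* dx))
      refl s t ex ey dx dy

  -- A side that is on the left when looking from p to q is on the right when looking back. Hence
  -- the fans at the two ends carry opposite signs `ω` and `- ω`.
  det-reverse : ∀ ω p q d → ω * det (q -ₚ p) d ≈ - ω * det (p -ₚ q) d
  det-reverse ω (px , py) (qx , qy) (dx , dy) =
    solve 7 (λ ω px py qx qy dx dy →
      ω :* ((qx :- px) :* dy :- (qy :- py) :* dx) :=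
      (:- ω) :* ((px :- qx) :* dy :- (py :- qy) :* dx))
      refl ω px py qx qy dx dy

  -- Opaque, since unification must not expand these polynomials.
  opaque
    -- Twice the signed area of the triangle pqr, times `ω`. With `ω` equal to 1 or -1, one argument
    -- serves both sides of the line ab.
    orient : Carrier → Point → Point → Point → Carrier
    orient ω p q r = ω * det (q -ₚ p) (r -ₚ p)

    orient-cong : ∀ ω {p q q′ r r′} → q ≈ₚ q′ → r ≈ₚ r′ →
      orient ω p q r ≈ orient ω p q′ r′
    orient-cong ω (x , y) (x′ , y′) =
      *-congˡ (det-cong (+-congʳ x , +-congʳ y) (+-congʳ x′ , +-congʳ y′))

    :orient : ∀ {m} (ω px py qx qy rx ry : Polynomial m) → Polynomial m
    :orient ω px py qx qy rx ry =
      ω :* ((qx :- px) :* (ry :- py) :- (qy :- py) :* (rx :- px))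

    orient-affine : ∀ ω s o p q r →
      orient ω o (p +ₚ s ·ₚ (q -ₚ p)) r ≈ (1# - s) * orient ω o p r + s * orient ω o q r
    orient-affine ω s (ox , oy) (px , py) (qx , qy) (rx , ry) =
      solve 10 (λ ω s ox oy px py qx qy rx ry →
        :orient ω ox oy (px :+ s :* (qx :- px)) (py :+ s :* (qy :- py)) rx ry :=
        (con (+ 1) :- s) :* :orient ω ox oy px py rx ry :+ s :* :orient ω ox oy qx qy rx ry)
        refl ω s ox oy px py qx qy rx ry

    orient-diagonal : ∀ ω p q → orient ω p q q ≈ 0#
    orient-diagonal ω (px , py) (qx , qy) =
      solve 5 (λ ω px py qx qy → :orient ω px py qx qy qx qy := con (+ 0)) refl ω px py qx qy

    orient-degenerate : ∀ ω p q → orient ω p p q ≈ 0#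
    orient-degenerate ω (px , py) (qx , qy) =
      solve 5 (λ ω px py qx qy → :orient ω px py px py qx qy := con (+ 0)) refl ω px py qx qy

    orient-swap : ∀ ω p q r → orient ω p q r + orient ω p r q ≈ 0#
    orient-swap ω (px , py) (qx , qy) (rx , ry) =
      solve 7 (λ ω px py qx qy rx ry →
        :orient ω px py qx qy rx ry :+ :orient ω px py rx ry qx qy := con (+ 0))
        refl ω px py qx qy rx ry

    -- The quadrilateral pqrs is cut along pr or along qs.
    orient-quadrilateral : ∀ ω p q r s →
      orient ω p q r + orient ω p r s - orient ω p q s ≈ orient (- ω) q s r
    orient-quadrilateral ω (px , py) (qx , qy) (rx , ry) (sx , sy) =
      solve 9 (λ ω px py qx qy rx ry sx sy →
        :orient ω px py qx qy rx ry :+ :orient ω px py rx ry sx sy :- :orient ω px py qx qy sx sy :=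
        :orient (:- ω) qx qy sx sy rx ry) refl ω px py qx qy rx ry sx sy

    -- One coordinate of the intersection formula, as an unconditional identity. The hypothesis that
    -- `w` inverts the determinant enters through a correction term, a multiple of 1 - w(oqi + oij),
    -- which `defect` shows to vanish.
    :cramer : ∀ {m} (ω w ox oy qx qy ix iy jx jy o q i j : Polynomial m) →
      Polynomial m × Polynomial m
    :cramer ω w ox oy qx qy ix iy jx jy o q i j =
      let oqi = :orient ω ox oy qx qy ix iy
          oqj = :orient ω ox oy qx qy jx jy
          oij = :orient ω ox oy ix iy jx jy in
      o :+ (w :* oqj) :* (i :- o) :+ (q :- o) :* (con (+ 1) :- w :* (oqi :+ oij)) :=
      q :+ (w :* oqi) :* (j :- q)

    -- Cramer's rule for the intersection of the lines oi and qj.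
    orient-cramer : ∀ ω w o q i j →
      w * (orient ω o q i + orient ω o i j) ≈ 1# →
      o +ₚ (w * orient ω o q j) ·ₚ (i -ₚ o) ≈ₚ q +ₚ (w * orient ω o q i) ·ₚ (j -ₚ q)
    orient-cramer ω w o@(ox , oy) q@(qx , qy) i@(ix , iy) j@(jx , jy) eq =
      trans (defect ox qx)
        (solve 10 (λ ω w ox oy qx qy ix iy jx jy →
          :cramer ω w ox oy qx qy ix iy jx jy ox qx ix jx)
          refl ω w ox oy qx qy ix iy jx jy) ,
      trans (defect oy qy)
        (solve 10 (λ ω w ox oy qx qy ix iy jx jy →
          :cramer ω w ox oy qx qy ix iy jx jy oy qy iy jy)
          refl ω w ox oy qx qy ix iy jx jy)
      where
      defect : ∀ x y {z} → z ≈ z + (y - x) * (1# - w * (orient ω o q i + orient ω o i j))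
      defect x y = sym (+-zeroʳ (*-zeroʳ (y - x) (trans (+-congˡ (-‿cong eq)) (-‿inverseʳ 1#))))

    orient-rayʳ : ∀ ω o q t d → orient ω o q (o +ₚ t ·ₚ d) ≈ t * (ω * det (q -ₚ o) d)
    orient-rayʳ ω (ox , oy) (qx , qy) t (dx , dy) =
      solve 8 (λ ω ox oy qx qy t dx dy →
        :orient ω ox oy qx qy (ox :+ t :* dx) (oy :+ t :* dy) :=
        t :* (ω :* ((qx :- ox) :* dy :- (qy :- oy) :* dx)))
        refl ω ox oy qx qy t dx dy

    orient-rays : ∀ ω o t d t′ d′ →
      orient ω o (o +ₚ t ·ₚ d) (o +ₚ t′ ·ₚ d′) ≈ t * (t′ * (ω * det d d′))
    orient-rays ω (ox , oy) t (dx , dy) t′ (ex , ey) =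
      solve 9 (λ ω ox oy t dx dy t′ ex ey →
        :orient ω ox oy (ox :+ t :* dx) (oy :+ t :* dy) (ox :+ t′ :* ex) (oy :+ t′ :* ey) :=
        t :* (t′ :* (ω :* (dx :* ey :- dy :* ex))))
        refl ω ox oy t dx dy t′ ex ey

  -- The points lie on rays from o; rank lists these rays by their angle with oq.
  -- The sign ω makes all points lie to the left of oq.
  record Fan {n} (ω : Carrier) (o q : Point)
             (pts : Fin n → Point) (rank : Fin n → Fin n) : Set ℓ₃ where
    field
      rank-injective : ∀ {i j} → rank i ≡ rank j → i ≡ j
      above  : ∀ i → Positive (orient ω o q (pts i))
      sorted : ∀ {i j} → rank i < rank j → Positive (orient ω o (pts i) (pts j))

    -- Signs of field elements cannot be decided, but ranks can be compared. In the two wrong cases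
    -- the area is zero, or it and its positive opposite cancel, against the positivity of `x`.
    rank-reflects : ∀ {i j t x} → Positive t → Positive x →
      t * orient ω o (pts i) (pts j) ≈ x → rank i < rank j
    rank-reflects {i} {j} {t} {x} 0<t 0<x eq with <-cmp (rank i) (rank j)
    ... | tri< lt _ _ = lt
    ... | tri> _ _ gt = contradiction (+-positive 0<x (*-positive 0<t (sorted gt)))
      (¬pos-0 (trans (+-congʳ (sym eq)) (trans (sym (distribˡ t _ _))
        (*-zeroʳ t (orient-swap ω o (pts i) (pts j))))))
    ... | tri≈ _ ri≡rj _ with rank-injective ri≡rj
    ...   | ≡.refl = contradiction 0<x
      (¬pos-0 (trans (sym eq) (*-zeroʳ t (orient-diagonal ω o (pts i)))))

    orient-along : ∀ {p i} j → ((t , _) : InSegment p o (pts i)) →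
      orient ω o p (pts j) ≈ t * orient ω o (pts i) (pts j)
    orient-along {i = i} j (t , _ , _ , p≈) =
      trans (orient-cong ω p≈ ≈ₚ-refl)
      (trans (orient-affine ω t o o (pts i) (pts j))
        (+-zeroˡ (*-zeroʳ (1# - t) (orient-degenerate ω o (pts j)))))

    -- Compute the area of o, p, j in two ways. As p lies on oi, it is t times that of o, i, j; as p
    -- lies on qj, it is 1 - s times that of o, q, j, which is positive.
    crossing⇒rank : ∀ {p i j} → InSegment p o (pts i) → InSegment p q (pts j) → rank i < rank j
    crossing⇒rank {j = j} p∈oi@(t , 0<t , _ , _) (s , _ , s<1 , p≈) =
      rank-reflects 0<t (*-positive (<ᴿ⇒positive s<1) (above j))
        (trans (sym (orient-along j p∈oi)) (trans (orient-cong ω p≈ ≈ₚ-refl)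
          (trans (orient-affine ω s o q (pts j) (pts j))
            (+-zeroʳ (*-zeroʳ s (orient-diagonal ω o (pts j)))))))

    -- The same area of o, p, j would be positive, since p lies on oi, and zero, since p lies on oj.
    common-point⇒¬rank : ∀ {p i j} → InSegment p o (pts i) → InSegment p o (pts j) → ¬ rank i < rank j
    common-point⇒¬rank {j = j} p∈oi@(t , 0<t , _) p∈oj@(s , _) lt = ¬pos-0
      (trans (sym (orient-along j p∈oi)) (trans (orient-along j p∈oj)
        (*-zeroʳ s (orient-diagonal ω o (pts j)))))
      (*-positive 0<t (sorted lt))

    common-point⇒≡ : ∀ {p i j} → InSegment p o (pts i) → InSegment p o (pts j) → i ≡ j
    common-point⇒≡ {i = i} {j} p∈oi p∈oj with <-cmp (rank i) (rank j)
    ... | tri< lt _ _ = contradiction lt (common-point⇒¬rank p∈oi p∈oj)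
    ... | tri≈ _ eq _ = rank-injective eq
    ... | tri> _ _ gt = contradiction gt (common-point⇒¬rank p∈oj p∈oi)

  module _ {n ω o q} {pts : Fin n → Point} {rank rank′}
           (F : Fan ω o q pts rank) (F′ : Fan (- ω) q o pts rank′) where
    private
      module F  = Fan F
      module F′ = Fan F′

    rank⇒crossing : ∀ {i j} → rank i < rank j → rank′ j < rank′ i →
      ∃[ p ] (InSegment p o (pts i) × InSegment p q (pts j))
    rank⇒crossing {i} {j} lt gt =
      -- By Cramer's rule the lines oi and qj meet at parameters B / (A + C) and A / (A + C). The
      -- second is below 1 since C is positive, the first since A + C - B is an area at q, positive
      -- by the order of the other fan.
      let A = orient ω o q (pts i)
          B = orient ω o q (pts j)
          C = orient ω o (pts i) (pts j)
          w , 0<w , w[A+C]≈1 = reciprocal (+-positive (F.above i) (F.sorted lt))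
          below-1 : ∀ {x} → Positive ((A + C) - x) → w * x <ᴿ 1#
          below-1 {x} pos = positive⇒<ᴿ (pos-resp
            (trans (solve 3 (λ w x y → w :* (y :- x) := w :* y :- w :* x) refl w x (A + C)) (+-congʳ w[A+C]≈1))
            (*-positive 0<w pos))
      in o +ₚ (w * B) ·ₚ (pts i -ₚ o) ,
         (w * B , *-positive 0<w (F.above j) ,
           below-1 (pos-resp (sym (orient-quadrilateral ω o q (pts i) (pts j))) (F′.sorted gt)) , ≈ₚ-refl) ,
         (w * A , *-positive 0<w (F.above i) ,
           below-1 (pos-resp (solve 2 (λ x y → y := (x :+ y) :- x) refl A C) (F.sorted lt)) ,
           orient-cramer ω w o q (pts i) (pts j) w[A+C]≈1)

  -- Distances along the rays scale areas by positive factors, so only directions matter. For two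
  -- directions in increasing order, `SmallerAngle` reduces their determinant to a positive multiple
  -- of the one between the base and the larger direction.
  rays⇒fan : ∀ {n ω o q} {pts : Fin n → Point} {rank : Fin n → Fin n} (γ : Fin n → Point) →
    (∀ {i j} → rank i ≡ rank j → i ≡ j) →
    (∀ k → Positive (ω * det (q -ₚ o) (γ k))) →
    (∀ {k l} → k < l → SmallerAngle (q -ₚ o) (γ k) (γ l)) →
    (∀ i → OnRay (pts i) o (γ (rank i))) →
    Fan ω o q pts rank
  rays⇒fan {ω = ω} {o} {q} {pts} {rank} γ rank-injective positive increasing on-ray = record
    { rank-injective = rank-injective ; above = above ; sorted = sorted }
    where
    above : ∀ i → Positive (orient ω o q (pts i))
    above i with on-ray i
    ... | t , 0<t , pᵢ≈ = pos-resp
      (sym (trans (orient-cong ω ≈ₚ-refl pᵢ≈) (orient-rayʳ ω o q t (γ (rank i)))))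
      (*-positive 0<t (positive (rank i)))

    sorted : ∀ {i j} → rank i < rank j → Positive (orient ω o (pts i) (pts j))
    sorted {i} {j} lt with on-ray i | on-ray j | increasing lt
    ... | t , 0<t , pᵢ≈ | t′ , 0<t′ , pⱼ≈ | s , s′ , 0<s , _ , γᵢ≈ = pos-resp
      (sym (trans (orient-cong ω pᵢ≈ pⱼ≈) (trans (orient-rays ω o t (γ (rank i)) t′ (γ (rank j)))
        (*-congˡ (*-congˡ (trans
          (*-congˡ (trans (det-cong γᵢ≈ ≈ₚ-refl) (det-smallerAngle s s′ (q -ₚ o) (γ (rank j)))))
          (solve 3 (λ ω s d → ω :* (s :* d) := s :* (ω :* d)) refl ω s _)))))))
      (*-positive 0<t (*-positive 0<t′ (*-positive 0<s (positive (rank j)))))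

open ≡ using (refl; sym; trans; cong; cong₂; subst; subst₂)

-- Injective self-maps of a finite set

module _ {ℓ} {A : Set ℓ} {H : A → A} (H-injective : Injective _≡_ _≡_ H) where

  fold-injective : ∀ k {x y} → fold x H k ≡ fold y H k → x ≡ y
  fold-injective zero    eq = eq
  fold-injective (suc k) eq = fold-injective k (H-injective eq)

  module _ {N} {code : A → Fin N} (code-injective : Injective _≡_ _≡_ code) where

    -- Two of the first N + 1 iterates coincide, and injectivity cancels the earlier exponent. The
    -- return takes at least one step, so that its last step can be removed afterwards.
    recurrent : ∀ x → ∃[ k ] fold x H (suc k) ≡ x
    recurrent x with pigeonhole (ℕ.n<1+n N) (λ i → code (fold x H (toℕ i)))
    ... | i , j , i<j , eq with ℕ.m≤n⇒∃[o]m+o≡n i<j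
    ...   | k , i+k≡j = k , sym (fold-injective (toℕ i) (trans (code-injective eq)
              (trans (cong (fold x H) (sym (trans (ℕ.+-suc (toℕ i) k) i+k≡j)))
                     (fold-+ x H (toℕ i)))))

    -- By recurrence `x` is itself an iterate of `H x`, so the property is carried forward round the
    -- cycle.
    invariant⇒reflected : ∀ {p} {P : Pred A p} → (∀ {x} → P x → P (H x)) → ∀ {x} → P (H x) → P x
    invariant⇒reflected {P = P} step {x} PHx with recurrent (H x)
    ... | k , eq = subst P (H-injective eq) (iterated k)
      where
      iterated : ∀ k → P (fold (H x) H k)
      iterated zero    = PHx
      iterated (suc k) = step (iterated k)

private variable
  n : ℕ

-- Finite codes for quadruples of vertices

vertex-code : K₂-Vertex n → Fin (2 ℕ.+ n)
vertex-code a      = zero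
vertex-code b      = suc zero
vertex-code (pt i) = suc (suc i)

vertex-code-injective : Injective _≡_ _≡_ (vertex-code {n})
vertex-code-injective {x = a}    {a}    _    = refl
vertex-code-injective {x = b}    {b}    _    = refl
vertex-code-injective {x = pt _} {pt _} refl = refl

Quad : Set → Set
Quad V = (V × V) × (V × V)

mapQuad : ∀ {V W} → (V → W) → Quad V → Quad W
mapQuad f = Product.map (Product.map f f) (Product.map f f)

mapQuad-injective : ∀ {V W} {f : V → W} → Injective _≡_ _≡_ f → Injective _≡_ _≡_ (mapQuad f)
mapQuad-injective inj {(x , y) , (u , v)} {(x′ , y′) , (u′ , v′)} eq =
  cong₂ _,_ (cong₂ _,_ (inj (cong (proj₁ ∘ proj₁) eq)) (inj (cong (proj₂ ∘ proj₁) eq)))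
            (cong₂ _,_ (inj (cong (proj₁ ∘ proj₂) eq)) (inj (cong (proj₂ ∘ proj₂) eq)))

combineQuad : ∀ {m} → Quad (Fin m) → Fin ((m ℕ.* m) ℕ.* (m ℕ.* m))
combineQuad ((x , y) , (u , v)) = combine (combine x y) (combine u v)

combineQuad-injective : ∀ {m} → Injective _≡_ _≡_ (combineQuad {m})
combineQuad-injective {m} {(x , y) , (u , v)} {(x′ , y′) , (u′ , v′)} eq
  with eq₁ , eq₂ ← combine-injective (combine x y) (combine u v) (combine x′ y′) (combine u′ v′) eq
  with refl , refl ← combine-injective x y x′ y′ eq₁
  with refl , refl ← combine-injective u v u′ v′ eq₂ = refl

-- Automorphisms induced by permutations, and their action on pairs

-- The Boolean says whether a and b are exchanged.
extend : Bool → Permutation′ n → K₂-Vertex n → K₂-Vertex n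
extend false ρ a      = a
extend false ρ b      = b
extend true  ρ a      = b
extend true  ρ b      = a
extend s     ρ (pt i) = pt (ρ ⟨$⟩ʳ i)

extend-flip : ∀ s (ρ : Permutation′ n) x → extend s ρ (extend s (flip ρ) x) ≡ x
extend-flip false ρ a      = refl
extend-flip false ρ b      = refl
extend-flip false ρ (pt i) = cong pt (inverseʳ ρ)
extend-flip true  ρ a      = refl
extend-flip true  ρ b      = refl
extend-flip true  ρ (pt i) = cong pt (inverseʳ ρ)

extend-adj : ∀ s (ρ : Permutation′ n) {x y} → K₂-Adj x y → K₂-Adj (extend s ρ x) (extend s ρ y)
extend-adj false ρ (a–pt i) = a–pt _
extend-adj false ρ (b–pt i) = b–pt _
extend-adj false ρ (pt–a i) = pt–a _
extend-adj false ρ (pt–b i) = pt–b _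
extend-adj true  ρ (a–pt i) = b–pt _
extend-adj true  ρ (b–pt i) = a–pt _
extend-adj true  ρ (pt–a i) = pt–b _
extend-adj true  ρ (pt–b i) = pt–a _

extension : Bool → Permutation′ n → K₂-Vertex n ↔ K₂-Vertex n
extension s ρ = mk↔ₛ′ (extend s ρ) (extend s (flip ρ)) (extend-flip s ρ) (extend-flip s (flip ρ))

Automorphism : K₂-Vertex n ↔ K₂-Vertex n → Set
Automorphism f = ∀ x y → K₂-Adj x y ⇔ K₂-Adj (to x) (to y)
  where open Inverse f using (to)

extension-automorphism : ∀ s (ρ : Permutation′ n) → Automorphism (extension s ρ)
extension-automorphism s ρ x y = mk⇔ (extend-adj s ρ)
  (subst₂ K₂-Adj (extend-flip s (flip ρ) x) (extend-flip s (flip ρ) y) ∘ extend-adj s (flip ρ))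

-- If a and b are exchanged, a crossing of bi and aj goes to one of aρ(i) and bρ(j), which belongs
-- to the pair (ρ(j), ρ(i)). In contrast to `act`, the result is not sorted.
image : Bool → Permutation′ n → Fin n × Fin n → Fin n × Fin n
image false ρ (i , j) = ρ ⟨$⟩ʳ i , ρ ⟨$⟩ʳ j
image true  ρ (i , j) = ρ ⟨$⟩ʳ j , ρ ⟨$⟩ʳ i

Increasing : Pred (Fin n × Fin n) 0ℓ
Increasing (i , j) = i < j

act≡image : ∀ s (ρ : Permutation′ n) p → image s ρ p ∈ Increasing → act ρ p ≡ image s ρ p
act≡image false ρ (i , j) lt rewrite dec-true  ((ρ ⟨$⟩ʳ i) <? (ρ ⟨$⟩ʳ j)) lt           = refl
act≡image true  ρ (i , j) gt rewrite dec-false ((ρ ⟨$⟩ʳ i) <? (ρ ⟨$⟩ʳ j)) (<-asym gt) = refl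

image-flip : ∀ s (ρ : Permutation′ n) p → image s ρ (image s (flip ρ) p) ≡ p
image-flip false ρ p = cong₂ _,_ (inverseʳ ρ) (inverseʳ ρ)
image-flip true  ρ p = cong₂ _,_ (inverseʳ ρ) (inverseʳ ρ)

-- Order-preserving for `false` and order-reversing for `true`, so that both alternatives are
-- treated at once.
MonotoneOn : Bool → Permutation′ n → Pred (Fin n × Fin n) 0ℓ → Set
MonotoneOn s ρ P = ∀ {p} → p ∈ P → image s ρ p ∈ Increasing

module _ (σ π ρ : Permutation′ n) where

  monotone⇒⊆ : ∀ s → MonotoneOn s ρ (E σ) → ρ ∗ E σ ⊆ E π → ∀ {p} → p ∈ E σ → image s ρ p ∈ E π
  monotone⇒⊆ s mono sub {p} p∈ = sub (p , p∈ , sym (act≡image s ρ p (mono p∈)))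

  -- Inversions are increasing pairs by definition, so monotonicity comes with the containment, and
  -- `act` then agrees with `image`.
  ⊆⇒monotone : ∀ s → (∀ {p} → p ∈ E σ → image s ρ p ∈ E π) → MonotoneOn s ρ (E σ) × ρ ∗ E σ ⊆ E π
  ⊆⇒monotone s sub = (λ p∈ → proj₁ (sub p∈)) ,
    λ { (p , p∈ , refl) → subst (_∈ E π) (sym (act≡image s ρ p (proj₁ (sub p∈)))) (sub p∈) }

-- Crossings of ray realizations are inversions

-- Closing the normal form bi, aj under the symmetries of crossing reduces claims about arbitrary
-- quadruples to the constructor `base`.
data Crossing (π : Permutation′ n) : (x y u v : K₂-Vertex n) → Set where
  base : ∀ {i j} → (i , j) ∈ E π → Crossing π b (pt i) a (pt j)
  turn : ∀ {x y u v} → Crossing π x y u v → Crossing π y x u v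
  swap : ∀ {x y u v} → Crossing π x y u v → Crossing π u v x y

crossing⇒inversion : ∀ {π : Permutation′ n} {x y u v} → Crossing π x y u v → ∃[ p ] p ∈ E π
crossing⇒inversion (base p∈) = _ , p∈
crossing⇒inversion (turn c)  = crossing⇒inversion c
crossing⇒inversion (swap c)  = crossing⇒inversion c

module _ {c ℓ₁ ℓ₂ ℓ₃} {ℝ : RealNumbers c ℓ₁ ℓ₂ ℓ₃} where
  private
    module ℝ = RealNumbers ℝ
  open Order ℝ
  open Algebra.Properties.Ring ring using (-1*x≈-x)
  open Orientation ℝ
  open Plane ℝ

  InSegment-sym : ∀ {p q r} → InSegment p q r → InSegment p r q
  InSegment-sym {_} {qx , qy} {rx , ry} (t , 0<t , t<1 , p≈x , p≈y) =
    ℝ.1# ℝ.- t , <ᴿ⇒positive t<1 ,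
    positive⇒<ᴿ (pos-resp (solve 1 (λ t → t := con (+ 1) :- (con (+ 1) :- t)) ℝ.refl t) 0<t) ,
    ℝ.trans p≈x (reverse qx rx) , ℝ.trans p≈y (reverse qy ry)
    where
    reverse : ∀ x y → x ℝ.+ t ℝ.* (y ℝ.- x) ℝ.≈ y ℝ.+ (ℝ.1# ℝ.- t) ℝ.* (x ℝ.- y)
    reverse x y = solve 3 (λ t x y → x :+ t :* (y :- x) := y :+ (con (+ 1) :- t) :* (x :- y)) ℝ.refl t x y

  module _ {G : SimpleGraph} (R : Realization ℝ G) where
    open SimpleGraph G renaming (sym to adj-sym)

    Cross-resp : ∀ {x x′ y y′ u u′ v v′} → x ≡ x′ → y ≡ y′ → u ≡ u′ → v ≡ v′ →
      Cross R x y u v → Cross R x′ y′ u′ v′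
    Cross-resp refl refl refl refl cr = cr

    Cross-turn : ∀ {x y u v} → Cross R x y u v → Cross R y x u v
    Cross-turn (p , xy , uv , distinct , p∈xy , p∈uv) =
      p , adj-sym xy , uv ,
      (λ { (inj₁ (y≡u , x≡v)) → distinct (inj₂ (x≡v , y≡u))
         ; (inj₂ (y≡v , x≡u)) → distinct (inj₁ (x≡u , y≡v)) }) ,
      InSegment-sym p∈xy , p∈uv

    Cross-swap : ∀ {x y u v} → Cross R x y u v → Cross R u v x y
    Cross-swap (p , xy , uv , distinct , p∈xy , p∈uv) =
      p , uv , xy ,
      (λ { (inj₁ (u≡x , v≡y)) → distinct (inj₁ (sym u≡x , sym v≡y))
         ; (inj₂ (u≡y , v≡x)) → distinct (inj₂ (sym v≡x , sym u≡y)) }) ,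
      p∈uv , p∈xy

  module Ray {π : Permutation′ n} (K : RayRealization ℝ π) where
    open RayRealization K public

    fans-from : ∀ ω → (∀ k → Positive (ω ℝ.* det ab (α k))) → (∀ k → Positive (ω ℝ.* det ab (β k))) →
      Fan ω (pos a) (pos b) (pos ∘ pt) (π ⟨$⟩ˡ_) × Fan (ℝ.- ω) (pos b) (pos a) (pos ∘ pt) id
    fans-from ω α-positive β-positive =
      rays⇒fan α (Injection.injective (↔⇒↣ (flip π))) α-positive α-increasing pt-on-α ,
      rays⇒fan β id (λ k → pos-resp (det-reverse ω (pos a) (pos b) (β k)) (β-positive k))
        β-increasing pt-on-β

    opaque
      -- The sign is 1 or -1 according to the side of ab on which the rays lie. Rays from a are
      -- ranked by the inverse of π, rays from b by the label itself.
      fans : ∃[ ω ] (Fan ω (pos a) (pos b) (pos ∘ pt) (π ⟨$⟩ˡ_) ×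
                     Fan (ℝ.- ω) (pos b) (pos a) (pos ∘ pt) id)
      fans with sameSide
      ... | inj₁ (α>0 , β>0) = ℝ.1# , fans-from ℝ.1# (scale ∘ α>0) (scale ∘ β>0)
        where
        scale : ∀ {x} → Positive x → Positive (ℝ.1# ℝ.* x)
        scale {x} = pos-resp (ℝ.sym (ℝ.*-identityˡ x))
      ... | inj₂ (α<0 , β<0) = ℝ.- ℝ.1# , fans-from (ℝ.- ℝ.1#) (negate ∘ α<0) (negate ∘ β<0)
        where
        negate : ∀ {x} → x ℝ.<ᴿ ℝ.0# → Positive (ℝ.- ℝ.1# ℝ.* x)
        negate {x} x<0 = pos-resp (ℝ.sym (-1*x≈-x x)) (<ᴿ0⇒positive x<0)

    private
      module A = Fan (proj₁ (proj₂ fans))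
      module B = Fan (proj₂ (proj₂ fans))

    inversion⇒Cross : ∀ {i j} → (i , j) ∈ E π → Cross realization b (pt i) a (pt j)
    inversion⇒Cross {i} {j} (i<j , π⁻¹j<π⁻¹i) =
      let p , p∈aj , p∈bi = rank⇒crossing (proj₁ (proj₂ fans)) (proj₂ (proj₂ fans)) π⁻¹j<π⁻¹i i<j
      in p , b–pt i , a–pt j , (λ { (inj₁ (() , _)) ; (inj₂ (() , _)) }) , p∈bi , p∈aj

    -- The fan at each hub contributes one of the two inequalities.
    Cross⇒inversion : ∀ {i j} → Cross realization b (pt i) a (pt j) → (i , j) ∈ E π
    Cross⇒inversion (p , _ , _ , _ , p∈bi , p∈aj) =
      B.crossing⇒rank p∈bi p∈aj , A.crossing⇒rank p∈aj p∈bi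

    -- Turn both edges so that they start at a hub. Two edges from the same hub lie on different
    -- rays unless they are equal, so only pairs with one edge at each hub remain.
    Cross⇒Crossing : ∀ {x y u v} → Cross realization x y u v → Crossing π x y u v
    Cross⇒Crossing cr@(_ , xy , uv , _) = at-hubˡ xy uv cr
      where
      P : (x y u v : K₂-Vertex n) → Set _
      P x y u v = Cross realization x y u v → Crossing π x y u v

      turnʳ : ∀ {x y u v} → Cross realization x y u v → Cross realization x y v u
      turnʳ = Cross-swap realization ∘ Cross-turn realization ∘ Cross-swap realization

      at-hubʳ : ∀ {x y u v} → K₂-Adj u v →
        (∀ i → P x y a (pt i)) → (∀ i → P x y b (pt i)) → P x y u v
      at-hubʳ (a–pt i) onA onB cr = onA i cr
      at-hubʳ (b–pt i) onA onB cr = onB i cr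
      at-hubʳ (pt–a i) onA onB cr = swap (turn (swap (onA i (turnʳ cr))))
      at-hubʳ (pt–b i) onA onB cr = swap (turn (swap (onB i (turnʳ cr))))

      meet-aa : ∀ i j → P a (pt i) a (pt j)
      meet-aa i j (_ , _ , _ , distinct , p∈ai , p∈aj) =
        contradiction (inj₁ (refl , cong pt (A.common-point⇒≡ p∈ai p∈aj))) distinct

      meet-bb : ∀ i j → P b (pt i) b (pt j)
      meet-bb i j (_ , _ , _ , distinct , p∈bi , p∈bj) =
        contradiction (inj₁ (refl , cong pt (B.common-point⇒≡ p∈bi p∈bj))) distinct

      meet-ba : ∀ i j → P b (pt i) a (pt j)
      meet-ba i j cr = base (Cross⇒inversion cr)

      meet-ab : ∀ i j → P a (pt i) b (pt j)
      meet-ab i j cr = swap (meet-ba j i (Cross-swap realization cr))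

      at-hubˡ : ∀ {x y u v} → K₂-Adj x y → K₂-Adj u v → P x y u v
      at-hubˡ (a–pt i) uv cr = at-hubʳ uv (meet-aa i) (meet-ab i) cr
      at-hubˡ (b–pt i) uv cr = at-hubʳ uv (meet-ba i) (meet-bb i) cr
      at-hubˡ (pt–a i) uv cr = turn (at-hubˡ (a–pt i) uv (Cross-turn realization cr))
      at-hubˡ (pt–b i) uv cr = turn (at-hubˡ (b–pt i) uv (Cross-turn realization cr))

open RayRealization using (realization)

-- Automorphisms of the graph

data Hub {n} : K₂-Vertex n → Set where
  hub-a : Hub a
  hub-b : Hub b

adj-pt : ∀ {i : Fin n} {x} → K₂-Adj (pt i) x → Hub x
adj-pt (pt–a _) = hub-a
adj-pt (pt–b _) = hub-b

hub-adj : ∀ {x : K₂-Vertex n} i → Hub x → K₂-Adj x (pt i)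
hub-adj i hub-a = a–pt i
hub-adj i hub-b = b–pt i

adj-hub : ∀ {x y : K₂-Vertex n} → Hub x → K₂-Adj x y → ∃[ i ] y ≡ pt i
adj-hub hub-a (a–pt i) = i , refl
adj-hub hub-b (b–pt i) = i , refl

hub-index : ∀ {x : K₂-Vertex n} → Hub x → Fin 2
hub-index hub-a = zero
hub-index hub-b = suc zero

hub-index-injective : ∀ {x y : K₂-Vertex n} (h : Hub x) (k : Hub y) → hub-index h ≡ hub-index k → x ≡ y
hub-index-injective hub-a hub-a _ = refl
hub-index-injective hub-b hub-b _ = refl

pt-injective : ∀ {i j : Fin n} → pt i ≡ pt j → i ≡ j
pt-injective refl = refl

automorphism-sym : (f : K₂-Vertex n ↔ K₂-Vertex n) → Automorphism f → Automorphism (↔-sym f)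
automorphism-sym f f-auto x y = mk⇔
  (λ xy → Equivalence.from (f-auto (from x) (from y))
    (subst₂ K₂-Adj (sym (strictlyInverseˡ x)) (sym (strictlyInverseˡ y)) xy))
  (λ xy → subst₂ K₂-Adj (strictlyInverseˡ x) (strictlyInverseˡ y)
    (Equivalence.to (f-auto (from x) (from y)) xy))
  where open Inverse f

-- An automorphism that takes a hub to a point of degree 2 forces n = 2.
hub-preserved : n ≢ 2 → (f : K₂-Vertex n ↔ K₂-Vertex n) → Automorphism f →
  ∀ {x} → Hub x → Hub (Inverse.to f x)
hub-preserved {n} n≢2 f f-auto {x} hx = go (to x) refl
  where
  open Inverse f
  module _ {i} (fx≡pt : to x ≡ pt i) where

    hub-image : ∀ k → Hub (to (pt k))
    hub-image k = adj-pt (subst (λ v → K₂-Adj v (to (pt k))) fx≡pt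
      (Equivalence.to (f-auto x (pt k)) (hub-adj k hx)))

    -- All points are sent to neighbours of `pt i`, and these are just the two hubs.
    n≤2 : n ℕ.≤ 2
    n≤2 = injective⇒≤ {f = hub-index ∘ hub-image} λ {k} {l} eq → pt-injective
      (Injection.injective (↔⇒↣ f) (hub-index-injective (hub-image k) (hub-image l) eq))

    -- Conversely both hubs come from neighbours of `x`, that is, from two different points; so
    -- there are at least two points.
    hub-preimage : ∀ {y} → K₂-Adj (pt i) y → ∃[ k ] from y ≡ pt k
    hub-preimage {y} iy = adj-hub hx (Equivalence.from (f-auto x (from y))
      (subst₂ K₂-Adj (sym fx≡pt) (sym (strictlyInverseˡ y)) iy))

    preimage-distinct : proj₁ (hub-preimage (pt–a i)) ≢ proj₁ (hub-preimage (pt–b i))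
    preimage-distinct eq with () ← Injection.injective (↔⇒↣ (↔-sym f))
      (trans (proj₂ (hub-preimage (pt–a i))) (trans (cong pt eq) (sym (proj₂ (hub-preimage (pt–b i))))))

  two-distinct : ∀ {m} {k l : Fin m} → k ≢ l → 2 ℕ.≤ m
  two-distinct {suc zero}    {zero} {zero} k≢l = contradiction refl k≢l
  two-distinct {suc (suc m)} _ = s≤s (s≤s z≤n)

  go : ∀ y → to x ≡ y → Hub y
  go a      _  = hub-a
  go b      _  = hub-b
  go (pt i) eq = contradiction (ℕ.≤-antisym (n≤2 eq) (two-distinct (preimage-distinct eq))) n≢2

-- Both `f` and its inverse preserve hubs, hence also points. The restrictions to the points are
-- mutually inverse and give ρ; the Boolean records what happens to the hubs.
automorphism-extends : n ≢ 2 → (f : K₂-Vertex n ↔ K₂-Vertex n) → Automorphism f →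
  ∃[ s ] ∃[ ρ ] (∀ x → Inverse.to f x ≡ extend s ρ x)
automorphism-extends {n} n≢2 f f-auto =
  combined (hub-preserved n≢2 f f-auto hub-a)
           (hub-preserved n≢2 f f-auto hub-b) refl refl
  where
  open Inverse f

  pt-image : (g : K₂-Vertex n ↔ K₂-Vertex n) → Automorphism g → ∀ i → ∃[ j ] Inverse.to g (pt i) ≡ pt j
  pt-image g g-auto i = go (Inverse.to g (pt i)) refl
    where
    -- If `pt i` went to a hub, the inverse automorphism would take that hub to `pt i`, making it a
    -- hub.
    not-hub : ∀ {y} → Inverse.to g (pt i) ≡ y → ¬ Hub y
    not-hub refl h with () ← subst Hub (Inverse.strictlyInverseʳ g (pt i))
      (hub-preserved n≢2 (↔-sym g) (automorphism-sym g g-auto) h)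

    go : ∀ y → Inverse.to g (pt i) ≡ y → ∃[ j ] y ≡ pt j
    go a      eq = contradiction hub-a (not-hub eq)
    go b      eq = contradiction hub-b (not-hub eq)
    go (pt j) _  = j , refl

  f⁻¹-auto : Automorphism (↔-sym f)
  f⁻¹-auto = automorphism-sym f f-auto

  ρ : Permutation′ n
  ρ = permutation (proj₁ ∘ pt-image f f-auto) (proj₁ ∘ pt-image (↔-sym f) f⁻¹-auto)
    (λ i → pt-injective (trans (sym (proj₂ (pt-image f f-auto _)))
      (trans (cong to (sym (proj₂ (pt-image (↔-sym f) f⁻¹-auto i)))) (strictlyInverseˡ (pt i)))))
    (λ i → pt-injective (trans (sym (proj₂ (pt-image (↔-sym f) f⁻¹-auto _)))
      (trans (cong from (sym (proj₂ (pt-image f f-auto i)))) (strictlyInverseʳ (pt i)))))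

  combined : ∀ {x y} → Hub x → Hub y → to a ≡ x → to b ≡ y →
    ∃[ s ] ∃[ ρ ] (∀ x → to x ≡ extend s ρ x)
  combined hub-a hub-b fa fb = false , ρ , λ { a → fa ; b → fb ; (pt i) → proj₂ (pt-image f f-auto i) }
  combined hub-b hub-a fa fb = true  , ρ , λ { a → fa ; b → fb ; (pt i) → proj₂ (pt-image f f-auto i) }
  combined hub-a hub-a fa fb with () ← Injection.injective (↔⇒↣ f) (trans fa (sym fb))
  combined hub-b hub-b fa fb with () ← Injection.injective (↔⇒↣ f) (trans fa (sym fb))

-- Comparison of two ray realizations

Fin2-unique : {p q : Fin 2 × Fin 2} → p ∈ Increasing → q ∈ Increasing → p ≡ q
Fin2-unique {zero , suc zero}     {zero , suc zero}     _ _ = refl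
Fin2-unique {suc zero , suc zero} (s≤s ()) _
Fin2-unique {zero , suc zero}     {suc zero , suc zero} _ (s≤s ())

module _ {c ℓ₁ ℓ₂ ℓ₃} {ℝ : RealNumbers c ℓ₁ ℓ₂ ℓ₃} {σ π : Permutation′ n}
         (Kσ : RayRealization ℝ σ) (Kπ : RayRealization ℝ π) where
  private
    module Kσ = Ray Kσ
    module Kπ = Ray Kπ
    R = realization Kσ
    S = realization Kπ

  Cross-map : (g : K₂-Vertex n → K₂-Vertex n) →
    (∀ {i j} → (i , j) ∈ E σ → Cross S (g b) (g (pt i)) (g a) (g (pt j))) →
    ∀ x y u v → Cross R x y u v → Cross S (g x) (g y) (g u) (g v)
  Cross-map g on-inversions x y u v cr = go (Kσ.Cross⇒Crossing cr)
    where
    go : ∀ {x y u v} → Crossing σ x y u v → Cross S (g x) (g y) (g u) (g v)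
    go (base p∈) = on-inversions p∈
    go (turn c)  = Cross-turn S (go c)
    go (swap c)  = Cross-swap S (go c)

module _ {c ℓ₁ ℓ₂ ℓ₃} {ℝ : RealNumbers c ℓ₁ ℓ₂ ℓ₃} {π : Permutation′ n}
         (Kπ : RayRealization ℝ π) where
  private
    module Kπ = Ray Kπ
    S = realization Kπ

  -- When the hubs are exchanged, the two image edges appear with a first; exchanging the edges
  -- restores the normal form.
  image⇒Cross : ∀ s ρ {i j} → image s ρ (i , j) ∈ E π →
    Cross S (extend s ρ b) (extend s ρ (pt i)) (extend s ρ a) (extend s ρ (pt j))
  image⇒Cross false ρ p∈ = Kπ.inversion⇒Cross p∈
  image⇒Cross true  ρ p∈ = Cross-swap S (Kπ.inversion⇒Cross p∈)

  Cross⇒image : ∀ s ρ {i j} →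
    Cross S (extend s ρ b) (extend s ρ (pt i)) (extend s ρ a) (extend s ρ (pt j)) →
    image s ρ (i , j) ∈ E π
  Cross⇒image false ρ cr = Kπ.Cross⇒inversion cr
  Cross⇒image true  ρ cr = Kπ.Cross⇒inversion (Cross-swap S cr)

module _ {c ℓ₁ ℓ₂ ℓ₃} {ℝ : RealNumbers c ℓ₁ ℓ₂ ℓ₃} {σ π : Permutation′ n}
         (Kσ : RayRealization ℝ σ) (Kπ : RayRealization ℝ π) where
  private
    module Kσ = Ray Kσ
    module Kπ = Ray Kπ
    R = realization Kσ
    S = realization Kπ

  Preserves Reflects : (K₂-Vertex n → K₂-Vertex n) → Set _
  Preserves f = ∀ x y u v → Cross R x y u v → Cross S (f x) (f y) (f u) (f v)
  Reflects  f = ∀ x y u v → Cross S (f x) (f y) (f u) (f v) → Cross R x y u v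

  Preserves-resp : ∀ {f g} → (∀ x → f x ≡ g x) → Preserves f → Preserves g
  Preserves-resp f≗g pres x y u v cr =
    Cross-resp S (f≗g x) (f≗g y) (f≗g u) (f≗g v) (pres x y u v cr)

  preserves⇔ : ∀ s ρ → Preserves (extend s ρ) ⇔ (∀ {p} → p ∈ E σ → image s ρ p ∈ E π)
  preserves⇔ s ρ = mk⇔
    (λ pres {(i , j)} p∈ → Cross⇒image Kπ s ρ (pres b (pt i) a (pt j) (Kσ.inversion⇒Cross p∈)))
    (λ sub → Cross-map Kσ Kπ (extend s ρ) (λ {i} {j} p∈ → image⇒Cross Kπ s ρ (sub {i , j} p∈)))

  extend-≼ : ∀ s ρ → Preserves (extend s ρ) → R ≼ S
  extend-≼ s ρ pres = extension s ρ , extension-automorphism s ρ , pres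

  -- Some map of this form is enough; it need not be the given one, which for n = 2 may send hubs to
  -- points.
  ≼⇒preserves : R ≼ S → ∃[ s ] ∃[ ρ ] Preserves (extend s ρ)
  ≼⇒preserves (f , f-auto , f-pres) with n ℕ.≟ 2
  ... | no n≢2 = let s , ρ , f≗ = automorphism-extends n≢2 f f-auto in
    s , ρ , Preserves-resp f≗ f-pres
  -- The 4-cycle K₂,₂ has automorphisms that mix hubs and points, but there is
  -- only one possible inversion, and the identity preserves it as well.
  ... | yes refl = false , Perm.id , Equivalence.from (preserves⇔ false Perm.id) only
    where
    only : ∀ {p} → p ∈ E σ → p ∈ E π
    only {i , j} p∈ =
      let q , q∈ = crossing⇒inversion (Kπ.Cross⇒Crossing
                     (f-pres b (pt i) a (pt j) (Kσ.inversion⇒Cross p∈)))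
      in subst (_∈ E π) (Fin2-unique (proj₁ q∈) (proj₁ p∈)) q∈

  -- Together with `preserves⇔`, this matches the equality of ρ ∗ E(σ) and E(π) with the extension
  -- of ρ being a geo-isomorphism.
  reflects⇔ : ∀ s ρ → MonotoneOn s ρ (E σ) → Reflects (extend s ρ) ⇔ (E π ⊆ ρ ∗ E σ)
  reflects⇔ s ρ mono = mk⇔ to from
    where
    to : Reflects (extend s ρ) → E π ⊆ ρ ∗ E σ
    to reflects {q} q∈ = p , p∈ , sym (trans (act≡image s ρ p (mono p∈)) p↦q)
      where
      p = image s (flip ρ) q
      p↦q : image s ρ p ≡ q
      p↦q = image-flip s ρ q
      p∈ : p ∈ E σ
      p∈ = Kσ.Cross⇒inversion (reflects b (pt (proj₁ p)) a (pt (proj₂ p))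
        (image⇒Cross Kπ s ρ (subst (_∈ E π) (sym p↦q) q∈)))

    from : E π ⊆ ρ ∗ E σ → Reflects (extend s ρ)
    from sup x y u v cr =
      Cross-resp R (undo x) (undo y) (undo u) (undo v)
        (Cross-map Kπ Kσ (extend s (flip ρ)) back
          (extend s ρ x) (extend s ρ y) (extend s ρ u) (extend s ρ v) cr)
      where
      back : ∀ {k l} → (k , l) ∈ E π → Cross R (extend s (flip ρ) b) (extend s (flip ρ) (pt k))
                                         (extend s (flip ρ) a) (extend s (flip ρ) (pt l))
      back q∈ with sup q∈
      ... | p , p∈ , refl = image⇒Cross Kσ s (flip ρ) (subst (_∈ E σ)
              (sym (trans (cong (image s (flip ρ)) (act≡image s ρ p (mono p∈))) (image-flip s (flip ρ) p))) p∈)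

      undo : ∀ x → extend s (flip ρ) (extend s ρ x) ≡ x
      undo = extend-flip s (flip ρ)

  -- The geo-isomorphism need not be related to `f`. The cycle argument is applied to the image
  -- under g of the quadruple, since `H` takes that image to the image under f.
  ≅⇒reflects : ∀ {f} → Injective _≡_ _≡_ f → Preserves f → R ≅ S → Reflects f
  ≅⇒reflects {f} f-inj f-pres (g , _ , g-iso) x y u v cr =
    Equivalence.from (g-iso x y u v)
      (invariant⇒reflected H-injective {code = combineQuad ∘ mapQuad vertex-code}
        (mapQuad-injective vertex-code-injective ∘ combineQuad-injective)
        {P = P} step {mapQuad to ((x , y) , (u , v))} at-g)
    where
    open Inverse g using (to; from; strictlyInverseˡ; strictlyInverseʳ)
    P : Quad (K₂-Vertex n) → Set _
    P ((x , y) , (u , v)) = Cross S x y u v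

    H : Quad (K₂-Vertex n) → Quad (K₂-Vertex n)
    H = mapQuad (f ∘ from)

    H-injective : Injective _≡_ _≡_ H
    H-injective = mapQuad-injective (Injection.injective (↔⇒↣ (↔-sym g)) ∘ f-inj)

    step : ∀ {q} → P q → P (H q)
    step {(x , y) , (u , v)} cr = f-pres (from x) (from y) (from u) (from v)
      (Equivalence.from (g-iso (from x) (from y) (from u) (from v))
        (Cross-resp S (sym (strictlyInverseˡ x)) (sym (strictlyInverseˡ y))
                      (sym (strictlyInverseˡ u)) (sym (strictlyInverseˡ v)) cr))

    f≗ : ∀ x → f x ≡ f (from (to x))
    f≗ x = cong f (sym (strictlyInverseʳ x))

    at-g : P (H (mapQuad to ((x , y) , (u , v))))
    at-g = Cross-resp S (f≗ x) (f≗ y) (f≗ u) (f≗ v) cr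

  -- The inclusion gives the order; its properness gives strictness. If the reverse inclusion held,
  -- the extension of ρ would be a geo-isomorphism; conversely, any geo-isomorphism forces this
  -- extension to reflect crossings, which yields the reverse inclusion.
  ≺⇔ : R ≺ S ⇔ (∃[ s ] ∃[ ρ ] (MonotoneOn s ρ (E σ) × (ρ ∗ E σ) ⊂ E π))
  ≺⇔ = mk⇔ to from
    where
    to : R ≺ S → ∃[ s ] ∃[ ρ ] (MonotoneOn s ρ (E σ) × (ρ ∗ E σ) ⊂ E π)
    to (R≼S , R≇S) with ≼⇒preserves R≼S
    ... | s , ρ , pres =
      let mono , sub = ⊆⇒monotone σ π ρ s (Equivalence.to (preserves⇔ s ρ) pres)
      in s , ρ , mono , sub , λ sup → R≇S (extension s ρ , extension-automorphism s ρ ,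
        λ x y u v → mk⇔ (pres x y u v) (Equivalence.from (reflects⇔ s ρ mono) sup x y u v))

    from : ∃[ s ] ∃[ ρ ] (MonotoneOn s ρ (E σ) × (ρ ∗ E σ) ⊂ E π) → R ≺ S
    from (s , ρ , mono , sub , ¬sup) = extend-≼ s ρ pres , λ R≅S → ¬sup
      (Equivalence.to (reflects⇔ s ρ mono)
        (≅⇒reflects (Injection.injective (↔⇒↣ (extension s ρ))) pres R≅S))
      where
      pres : Preserves (extend s ρ)
      pres = Equivalence.from (preserves⇔ s ρ) (monotone⇒⊆ σ π ρ s mono sub)

proposition5 : ∀ {c ℓ₁ ℓ₂ ℓ₃ : Level} (ℝ : RealNumbers c ℓ₁ ℓ₂ ℓ₃)
    {n : ℕ} (σ π : Permutation′ n)
    (K̄σ : RayRealization ℝ σ) (K̄π : RayRealization ℝ π) →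
    (realization K̄σ ≺ realization K̄π)
    ⇔ (∃[ ρ ] (((ρ ∗ E σ) ⊂ E π)
    × (OrderPreservingOn ρ (E σ) ⊎ OrderReversingOn ρ (E σ))))
proposition5 ℝ σ π K̄σ K̄π = mk⇔
  (λ R≺S → split (Equivalence.to (≺⇔ K̄σ K̄π) R≺S))
  λ { (ρ , sub , inj₁ mono) → Equivalence.from (≺⇔ K̄σ K̄π)
        (false , ρ , (λ {p} → mono (proj₁ p) (proj₂ p)) , sub)
    ; (ρ , sub , inj₂ mono) → Equivalence.from (≺⇔ K̄σ K̄π)
        (true , ρ , (λ {p} → mono (proj₁ p) (proj₂ p)) , sub) }
  where
  split : ∃[ s ] ∃[ ρ ] (MonotoneOn s ρ (E σ) × (ρ ∗ E σ) ⊂ E π) → _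
  split (false , ρ , mono , sub) = ρ , sub , inj₁ (λ i j → mono {i , j})
  split (true  , ρ , mono , sub) = ρ , sub , inj₂ (λ i j → mono {i , j})
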